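{- Let $n \geq 3$, let $G = K_n$ be the complete graph on $n$ vertices, and let $T_s$ be a star spanning tree of $G$. Then for every spanning tree $T$ of $G$, $$\cap(T_s) \leq \cap(T).$$
   Context: Let $G$ be a connected graph and $T$ a spanning tree of $G$. A cycle-edge of $T$ is an edge of $G$ not in $T$. Each cycle-edge $e$ induces a unique cycle in $T \cup \{e\}$, called a tree-cycle of $T$; $C_T$ is the set of tree-cycles of $T$. The intersection of two tree-cycles is the set of edges of $T$ belonging to both. For $c \in C_T$, the cycle intersection number $\cap_T(c)$ is the number of tree-cycles $c' \in C_T$ with $c' \neq c$ whose intersection with $c$ is non-empty. The tree intersection number of $T$ is $\cap(T) = \cap_G(T) = \frac{1}{2}\sum_{c \in C_T} \cap_T(c)$, i.e. the number of unordered pairs of distinct tree-cycles with non-empty intersection. A star spanning tree is a spanning tree having one vertex that is adjacent in the tree to all other vertices. -}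

module Defs where

open import Data.Bool.Properties using () renaming (_≟_ to _≟ᵇ_)
open import Data.Fin using (Fin; zero; suc)
import Data.Fin.Properties as Fin
open import Data.Fin.Subset
  using (Subset; inside; outside; _∈_; _∉_; _⊆_; _∩_; _∪_; ⁅_⁆)
open import Data.Fin.Subset.Properties using (_∈?_; _⊆?_; nonempty?)
open import Data.List
  using (List; []; _∷_; _++_; _∷ʳ_; [_]; map; zip; filter; length;
         lookup; allFin; upTo; cartesianProductWith)
open import Data.List.Membership.Propositional using (find; lose)
  renaming (_∈_ to _∈ˡ_)
open import Data.List.Membership.Propositional.Properties
  using (∈-allFin; ∈-lookup; ∈-upTo⁺; ∈-cartesianProductWith⁺)
open import Data.List.Relation.Unary.All as All using (All; all?)
open import Data.List.Relation.Unary.Any using (Any; here; any?)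
open import Data.List.Relation.Unary.Unique.Propositional using (Unique)
open import Data.List.Relation.Unary.AllPairs using () renaming (_∷_ to _∷ᵘ_)
import Data.List.Relation.Unary.Unique.DecPropositional as DecUnique
open import Data.Nat using (ℕ; zero; suc; _≤_; s≤s; _≤?_; ⌊_/2⌋)
open import Data.Nat.ListAction using (sum)
open import Data.Product using (∃; _×_; _,_; proj₁; proj₂)
open import Data.Product.Properties using (≡-dec)
open import Data.Sum using (_⊎_)
import Data.Vec as Vec
import Data.Vec.Properties as Vec
open import Relation.Binary using (DecidableEquality)
open import Relation.Binary.Construct.Closure.ReflexiveTransitive using (Star)
open import Relation.Binary.PropositionalEquality using (_≡_; _≢_; refl; sym; cong)
open import Relation.Nullary using (¬_; Dec; ¬?; _×-dec_; _⊎-dec_; _→-dec_; contradiction)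
open import Relation.Nullary.Decidable using (map′)

-- Edges are labelled by Fin m, so that sets of edges (spanning subgraphs,
-- cycles) are elements of Subset m. The labelling of the edges and the order in
-- which ends lists the two endpoints of an edge are arbitrary.
record Graph (n m : ℕ) : Set where
  field
    ends : Fin m → Fin n × Fin n

  Joins : Fin m → Fin n → Fin n → Set
  Joins e u v = ends e ≡ (u , v) ⊎ ends e ≡ (v , u)

  field
    loopless : ∀ e → proj₁ (ends e) ≢ proj₂ (ends e)
    simple   : ∀ {e f u v} → Joins e u v → Joins f u v → e ≡ f

cyclicPairs : ∀ {a} {A : Set a} → List A → List (A × A)
cyclicPairs []       = []
cyclicPairs (x ∷ xs) = zip (x ∷ xs) (xs ∷ʳ x)

lookup-injective : ∀ {a} {A : Set a} {xs : List A} → Unique xs →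
                   ∀ i j → lookup xs i ≡ lookup xs j → i ≡ j
lookup-injective (_  ∷ᵘ _) zero    zero    _  = refl
lookup-injective (px ∷ᵘ _) zero    (suc j) eq =
  contradiction eq (All.lookup px (∈-lookup j))
lookup-injective (px ∷ᵘ _) (suc i) zero    eq =
  contradiction (sym eq) (All.lookup px (∈-lookup i))
lookup-injective (_  ∷ᵘ u) (suc i) (suc j) eq = cong suc (lookup-injective u i j eq)

subsets : ∀ m → List (Subset m)
subsets zero    = [ Vec.[] ]
subsets (suc m) =
  map (inside Vec.∷_) (subsets m) ++ map (outside Vec.∷_) (subsets m)

_≟ˢ_ : ∀ {m} → DecidableEquality (Subset m)
_≟ˢ_ = Vec.≡-dec _≟ᵇ_

module _ {n m} (G : Graph n m) where
  open Graph G

  IsComplete : Set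
  IsComplete = ∀ {u v} → u ≢ v → ∃ λ e → Joins e u v

  AdjacentIn : Subset m → Fin n → Fin n → Set
  AdjacentIn S u v = ∃ λ e → e ∈ S × Joins e u v

  IsConnected : Subset m → Set
  IsConnected S = ∀ u v → Star (AdjacentIn S) u v

  -- c is the edge set of the cycle visiting the distinct vertices vs in order.
  CycleThrough : Subset m → List (Fin n) → Set
  CycleThrough c vs =
    3 ≤ length vs × Unique vs ×
    All (λ (u , v) → AdjacentIn c u v) (cyclicPairs vs) ×
    (∀ e → e ∈ c → Any (λ (u , v) → Joins e u v) (cyclicPairs vs))

  IsCycle : Subset m → Set
  IsCycle c = ∃ (CycleThrough c)

  IsAcyclic : Subset m → Set
  IsAcyclic S = ∀ c → c ⊆ S → ¬ IsCycle c

  IsSpanningTree : Subset m → Set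
  IsSpanningTree T = IsConnected T × IsAcyclic T

  IsStarSpanningTree : Subset m → Set
  IsStarSpanningTree T =
    IsSpanningTree T × ∃ λ s → ∀ v → v ≢ s → AdjacentIn T s v

  IsTreeCycle : Subset m → Subset m → Set
  IsTreeCycle T c = ∃ λ e → e ∉ T × c ⊆ T ∪ ⁅ e ⁆ × IsCycle c

  joins? : ∀ e u v → Dec (Joins e u v)
  joins? e u v = (ends e ≟ (u , v)) ⊎-dec (ends e ≟ (v , u))
    where _≟_ = ≡-dec Fin._≟_ Fin._≟_

  adjacentIn? : ∀ S u v → Dec (AdjacentIn S u v)
  adjacentIn? S u v = Fin.any? λ e → (e ∈? S) ×-dec joins? e u v

  cycleThrough? : ∀ c vs → Dec (CycleThrough c vs)
  cycleThrough? c vs =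
    (3 ≤? length vs) ×-dec DecUnique.unique? Fin._≟_ vs ×-dec
    all? (λ (u , v) → adjacentIn? c u v) (cyclicPairs vs) ×-dec
    Fin.all? λ e →
      (e ∈? c) →-dec any? (λ (u , v) → joins? e u v) (cyclicPairs vs)

  listsOfLength : ℕ → List (List (Fin n))
  listsOfLength zero    = [ [] ]
  listsOfLength (suc k) = cartesianProductWith _∷_ (allFin n) (listsOfLength k)

  ∈-listsOfLength : ∀ vs → vs ∈ˡ listsOfLength (length vs)
  ∈-listsOfLength []       = here refl
  ∈-listsOfLength (v ∷ vs) =
    ∈-cartesianProductWith⁺ _∷_ (∈-allFin v) (∈-listsOfLength vs)

  unique⇒length≤ : ∀ {vs : List (Fin n)} → Unique vs → length vs ≤ n
  unique⇒length≤ u = Fin.injective⇒≤ (λ {i} {j} → lookup-injective u i j)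

  isCycle? : ∀ c → Dec (IsCycle c)
  isCycle? c =
    map′ from to
      (any? (λ k → any? (cycleThrough? c) (listsOfLength k)) (upTo (suc n)))
    where
    from : Any (λ k → Any (CycleThrough c) (listsOfLength k)) (upTo (suc n)) →
           IsCycle c
    from p with find p
    ... | _ , _ , q with find q
    ... | vs , _ , r = vs , r

    to : IsCycle c →
         Any (λ k → Any (CycleThrough c) (listsOfLength k)) (upTo (suc n))
    to (vs , r@(_ , u , _)) =
      lose (∈-upTo⁺ (s≤s (unique⇒length≤ u))) (lose (∈-listsOfLength vs) r)

  isTreeCycle? : ∀ T c → Dec (IsTreeCycle T c)
  isTreeCycle? T c = Fin.any? λ e →
    ¬? (e ∈? T) ×-dec (c ⊆? (T ∪ ⁅ e ⁆)) ×-dec isCycle? c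

  treeCycles : Subset m → List (Subset m)
  treeCycles T = filter (isTreeCycle? T) (subsets m)

  intersection : Subset m → Subset m → Subset m → Subset m
  intersection T c c′ = T ∩ (c ∩ c′)

  cycleIntersectionNumber : Subset m → Subset m → ℕ
  cycleIntersectionNumber T c = length (filter
    (λ c′ → ¬? (c′ ≟ˢ c) ×-dec nonempty? (intersection T c c′))
    (treeCycles T))

  -- The sum counts ordered pairs under a symmetric irreflexive relation, so it
  -- is even and the halving is exact.
  treeIntersectionNumber : Subset m → ℕ
  treeIntersectionNumber T =
    ⌊ sum (map (cycleIntersectionNumber T) (treeCycles T)) /2⌋

{-# OPTIONS --safe #-}
module Submission where

-- Every tree-cycle of every spanning tree T of K_n meets at least 2 (n - 3)
-- other tree-cycles of T, and for a star it meets at most 2 (n - 3). All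
-- spanning trees have equally many tree-cycles, so summing over the tree-cycles
-- gives the inequality.
--
-- The tool for all of this is the cut of a tree edge d: a two-valued vertex
-- labelling changed, among the edges of T, exactly by d (cut-exists). A labelling
-- cannot change along exactly one edge of a cycle (cycle-preserves), so the
-- tree-cycle of a cycle-edge e contains d if and only if the cut of d separates
-- the ends of e (∈⇒crossing, crossing⇒∈). In particular e determines its
-- tree-cycle (tree-cycle-unique).
--
-- Lower bound (meets-≥): a tree-cycle c has at least three edges, hence contains
-- two tree edges d₁ and d₂. Their cuts together label the vertices with at least
-- three values; fix representatives α, β, γ of three of them. The three edges
-- between the representatives and, for each of the n - 3 other vertices, two
-- edges towards differently labelled representatives give 3 + 2 (n - 3) edges
-- with differently labelled ends (crossing-edges). Apart from d₁, d₂ and the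
-- cycle-edge of c, each of them is a cycle-edge whose tree-cycle contains d₁ or d₂
-- and so meets c.
--
-- Upper bound (star-meets-≤): in a star with centre s, the tree-cycle of a
-- cycle-edge with ends a and b meets only the tree-cycles of cycle-edges joining
-- a or b to one of the n - 3 vertices other than s, a, b.
--
-- Number of tree-cycles (star-treeCycles≤): tree-cycles correspond to
-- cycle-edges, and mapping an edge of T to the spoke of the star at its end
-- farther from s is an injection from T to the star (far-end-injective).

open import Defs
open import Data.Nat using (ℕ; _≤_)
open import Data.Fin.Subset using (Subset)

open import Data.Bool using (Bool; true; false)
open import Data.Bool.Properties using () renaming (_≟_ to _≟ᵇ_)
open import Data.Fin using (Fin)
open import Data.Fin.Properties using (_≟_)
open import Data.Fin.Subset using (Nonempty; _∈_; _∉_; _⊆_; _∪_; _∩_; ⁅_⁆; inside; outside)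
open import Data.Fin.Subset.Properties
  using (_∈?_; nonempty?; ⊆-antisym; x∈⁅x⁆; x∈⁅y⁆⇒x≡y; x∈p∪q⁻; x∈p∪q⁺; x∈p∩q⁺; x∈p∩q⁻)
open import Data.List
  using (List; []; _∷_; _++_; [_]; _∷ʳ_; map; zip; filter; length; allFin;
         cartesianProduct)
open import Data.List.Properties using (length-++-sucʳ; length-tabulate)
open import Data.List.Membership.Propositional using (find; lose)
  renaming (_∈_ to _∈ˡ_; _∉_ to _∉ˡ_)
open import Data.List.Membership.Propositional.Properties
  using (∈-∃++; ∈-++⁺ˡ; ∈-++⁺ʳ; ∈-++⁻; ∈-filter⁺; ∈-filter⁻; ∈-allFin; ∈-map⁺; ∈-map⁻;
         ∈-cartesianProduct⁺)
open import Data.List.Relation.Unary.All as All using (All; []; _∷_)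
open import Data.List.Relation.Unary.All.Properties using (¬Any⇒All¬; All¬⇒¬Any)
open import Data.List.Relation.Unary.Any using (Any; here; there; any?)
open import Data.List.Relation.Unary.AllPairs using ([]; _∷_)
open import Data.List.Relation.Unary.Unique.Propositional using (Unique)
import Data.List.Relation.Unary.Unique.Propositional.Properties as Unique
open import Data.Nat using (zero; suc; _+_; _*_; _∸_; z≤n; s≤s; s≤s⁻¹)
open import Data.Nat.ListAction using (sum)
open import Data.Nat.Properties
  using (≤-trans; ≤-reflexive; +-mono-≤; +-cancelˡ-≤; +-monoʳ-≤; +-monoˡ-≤; *-monoˡ-≤;
         ∸-monoˡ-≤; ⌊n/2⌋-mono; +-suc; module ≤-Reasoning)
open import Data.Product using (∃; ∃₂; _×_; _,_; proj₁; proj₂)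
open import Data.Product.Properties using (≡-dec)
open import Data.Sum using (_⊎_; inj₁; inj₂; swap; [_,_]′)
import Data.Vec as Vec
import Data.Vec.Properties as Vec
open import Function using (_∘_; const)
open import Relation.Binary.Construct.Closure.ReflexiveTransitive using (Star; ε; _◅_; _◅◅_; reverse)
open import Relation.Binary using (DecidableEquality)
open import Relation.Binary.PropositionalEquality
  using (_≡_; _≢_; refl; sym; trans; cong; cong₂; subst; ≢-sym)
open import Relation.Nullary using (¬_; Dec; yes; no; does; ¬?; _×-dec_; contradiction)
open import Relation.Nullary.Decidable using (dec-true; dec-false)
open import Relation.Unary using (Decidable)

-- Counting in lists

-- A relation that is total from xs to ys and never relates two elements to the
-- same one bounds the length of xs. No function has to be chosen.
length≤-by : ∀ {A B : Set} (R : A → B → Set) →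
  (∀ {x x′ y} → R x y → R x′ y → x ≡ x′) →
  ∀ {xs ys} → Unique xs → (∀ {x} → x ∈ˡ xs → ∃ λ y → y ∈ˡ ys × R x y) →
  length xs ≤ length ys
length≤-by R inj {[]} _ _ = z≤n
length≤-by R inj {x ∷ xs} (x∉xs ∷ uxs) total
  with y , y∈ys , Rxy ← total (here refl)
  with as , bs , refl ← ∈-∃++ y∈ys =
  ≤-trans (s≤s (length≤-by R inj uxs total′)) (≤-reflexive (sym (length-++-sucʳ as y bs)))
  where
  total′ : ∀ {x′} → x′ ∈ˡ xs → ∃ λ y′ → y′ ∈ˡ (as ++ bs) × R x′ y′
  total′ x′∈xs with y′ , y′∈ys , Rx′y′ ← total (there x′∈xs) | ∈-++⁻ as y′∈ys
  ... | inj₁ y′∈as         = y′ , ∈-++⁺ˡ y′∈as , Rx′y′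
  ... | inj₂ (there y′∈bs) = y′ , ∈-++⁺ʳ as y′∈bs , Rx′y′
  ... | inj₂ (here refl)   = contradiction (inj Rxy Rx′y′) (All.lookup x∉xs x′∈xs)

length≤-by-⊆ : ∀ {A : Set} {xs ys : List A} → Unique xs →
  (∀ {x} → x ∈ˡ xs → x ∈ˡ ys) → length xs ≤ length ys
length≤-by-⊆ uxs xs⊆ys =
  length≤-by _≡_ (λ x≡y x′≡y → trans x≡y (sym x′≡y)) uxs (λ x∈xs → _ , xs⊆ys x∈xs , refl)

length-filter-¬ : ∀ {A : Set} {P : A → Set} (P? : Decidable P) xs →
  length (filter P? xs) + length (filter (¬? ∘ P?) xs) ≡ length xs
length-filter-¬ P? []       = refl
length-filter-¬ P? (x ∷ xs) with does (P? x)
... | true  = cong suc (length-filter-¬ P? xs)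
... | false = trans (+-suc _ _) (cong suc (length-filter-¬ P? xs))

length-cartesianProduct₂ : ∀ {A B : Set} (xs : List A) {b b′ : B} →
  length (cartesianProduct xs (b ∷ b′ ∷ [])) ≡ length xs * 2
length-cartesianProduct₂ []       = refl
length-cartesianProduct₂ (x ∷ xs) = cong (2 +_) (length-cartesianProduct₂ xs)

sum-≤ : ∀ {A : Set} (f : A → ℕ) b xs → (∀ {x} → x ∈ˡ xs → f x ≤ b) →
  sum (map f xs) ≤ length xs * b
sum-≤ f b []       _  = z≤n
sum-≤ f b (x ∷ xs) ≤b = +-mono-≤ (≤b (here refl)) (sum-≤ f b xs (≤b ∘ there))

sum-≥ : ∀ {A : Set} (f : A → ℕ) b xs → (∀ {x} → x ∈ˡ xs → b ≤ f x) →
  length xs * b ≤ sum (map f xs)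
sum-≥ f b []       _  = z≤n
sum-≥ f b (x ∷ xs) b≤ = +-mono-≤ (b≤ (here refl)) (sum-≥ f b xs (b≤ ∘ there))

∈-subsets : ∀ {m} (p : Subset m) → p ∈ˡ subsets m
∈-subsets Vec.[]              = here refl
∈-subsets (inside Vec.∷ p)    = ∈-++⁺ˡ (∈-map⁺ _ (∈-subsets p))
∈-subsets (outside Vec.∷ p)   = ∈-++⁺ʳ _ (∈-map⁺ _ (∈-subsets p))

subsets-unique : ∀ m → Unique (subsets m)
subsets-unique zero    = [] ∷ []
subsets-unique (suc m) =
  Unique.++⁺ (Unique.map⁺ Vec.∷-injectiveʳ (subsets-unique m))
             (Unique.map⁺ Vec.∷-injectiveʳ (subsets-unique m)) disjoint
  where
  disjoint : ∀ {p} → ¬ (p ∈ˡ map (inside Vec.∷_) (subsets m) ×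
                        p ∈ˡ map (outside Vec.∷_) (subsets m))
  disjoint (p∈ , p∈′) with ∈-map⁻ _ p∈ | ∈-map⁻ _ p∈′
  ... | _ , _ , refl | _ , _ , ()

-- Subsets cut out by a predicate, and complements of three vertices

-- The set of elements satisfying a decidable predicate.
⟪_⟫ : ∀ {m} {P : Fin m → Set} → Decidable P → Subset m
⟪ P? ⟫ = Vec.tabulate (does ∘ P?)

module _ {m} {P : Fin m → Set} (P? : Decidable P) where

  ∈⟪⟫⁺ : ∀ {x} → P x → x ∈ ⟪ P? ⟫
  ∈⟪⟫⁺ {x} Px = Vec.lookup⇒[]= x _ (trans (Vec.lookup∘tabulate _ x) eq)
    where
    eq : does (P? x) ≡ true
    eq with P? x
    ... | yes _  = refl
    ... | no ¬Px = contradiction Px ¬Px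

  ∈⟪⟫⁻ : ∀ {x} → x ∈ ⟪ P? ⟫ → P x
  ∈⟪⟫⁻ {x} x∈ with P? x | trans (sym (Vec.lookup∘tabulate (does ∘ P?) x)) (Vec.[]=⇒lookup x∈)
  ... | yes Px | _ = Px

-- The vertices other than three given ones.
others : ∀ {n} → Fin n → Fin n → Fin n → List (Fin n)
others a b c = filter (λ x → ¬? (any? (x ≟_) (a ∷ b ∷ c ∷ []))) (allFin _)

module _ {n} (a b c : Fin n) where

  others-unique : Unique (others a b c)
  others-unique = Unique.filter⁺ _ (Unique.allFin⁺ n)

  ∈-others⁺ : ∀ {x} → x ∉ˡ (a ∷ b ∷ c ∷ []) → x ∈ˡ others a b c
  ∈-others⁺ = ∈-filter⁺ _ (∈-allFin _)

  ∈-others⁻ : ∀ {x} → x ∈ˡ others a b c → x ∉ˡ (a ∷ b ∷ c ∷ [])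
  ∈-others⁻ x∈ = proj₂ (∈-filter⁻ _ {xs = allFin n} x∈)

  length-allFin : length (allFin n) ≡ n
  length-allFin = length-tabulate {n = n} _

  others-≥ : n ∸ 3 ≤ length (others a b c)
  others-≥ = ∸-monoˡ-≤ 3 (≤-trans (≤-reflexive (sym length-allFin))
    (length≤-by-⊆ {ys = a ∷ b ∷ c ∷ others a b c} (Unique.allFin⁺ n) λ {x} _ → covers x))
    where
    covers : ∀ x → x ∈ˡ (a ∷ b ∷ c ∷ others a b c)
    covers x with any? (x ≟_) (a ∷ b ∷ c ∷ [])
    ... | yes p = ∈-++⁺ˡ p
    ... | no ¬p = there (there (there (∈-others⁺ ¬p)))

  others-≤ : a ≢ b → a ≢ c → b ≢ c → length (others a b c) ≤ n ∸ 3
  others-≤ a≢b a≢c b≢c = ∸-monoˡ-≤ 3 (≤-trans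
    (length≤-by-⊆ {xs = a ∷ b ∷ c ∷ others a b c} unique λ {x} _ → ∈-allFin x)
    (≤-reflexive length-allFin))
    where
    fresh : ∀ {y} → y ∈ˡ (a ∷ b ∷ c ∷ []) → All (y ≢_) (others a b c)
    fresh y∈ = All.tabulate λ { x∈ refl → ∈-others⁻ x∈ y∈ }

    unique : Unique (a ∷ b ∷ c ∷ others a b c)
    unique = (a≢b ∷ a≢c ∷ fresh (here refl)) ∷ (b≢c ∷ fresh (there (here refl))) ∷
             fresh (there (there (here refl))) ∷ others-unique

module _ {n m} (G : Graph n m) where
  open Graph G

  -- Edges and their ends

  joins-ends : ∀ {e u v x y} → Joins e u v → Joins e x y →
               (u ≡ x × v ≡ y) ⊎ (u ≡ y × v ≡ x)
  joins-ends (inj₁ p) (inj₁ q) with refl ← trans (sym p) q = inj₁ (refl , refl)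
  joins-ends (inj₁ p) (inj₂ q) with refl ← trans (sym p) q = inj₂ (refl , refl)
  joins-ends (inj₂ p) (inj₁ q) with refl ← trans (sym p) q = inj₂ (refl , refl)
  joins-ends (inj₂ p) (inj₂ q) with refl ← trans (sym p) q = inj₁ (refl , refl)

  joins-≢ : ∀ {e u v} → Joins e u v → u ≢ v
  joins-≢ {e} (inj₁ p) refl = loopless e (trans (cong proj₁ p) (sym (cong proj₂ p)))
  joins-≢ {e} (inj₂ p) refl = loopless e (trans (cong proj₁ p) (sym (cong proj₂ p)))

  joins-other : ∀ {e u v w} → Joins e u v → Joins e u w → v ≡ w
  joins-other j k with joins-ends j k
  ... | inj₁ (_ , v≡w)  = v≡w
  ... | inj₂ (u≡w , _) = contradiction u≡w (joins-≢ k)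

  other-end : ∀ {e u v w} → Joins e u v → w ≡ u ⊎ w ≡ v → ∃ λ x → Joins e w x
  other-end j (inj₁ refl) = _ , j
  other-end j (inj₂ refl) = _ , swap j

  joins-ends-of : ∀ e → ∃₂ λ u v → Joins e u v
  joins-ends-of e = _ , _ , inj₁ refl

  edges-differ : ∀ {g h x y u v} → Joins g x y → Joins h u v → x ≢ u → x ≢ v → g ≢ h
  edges-differ j k x≢u x≢v refl with joins-ends j k
  ... | inj₁ (x≡u , _) = x≢u x≡u
  ... | inj₂ (x≡v , _) = x≢v x≡v

  -- Paths and cycles

  -- Adjacency through an edge satisfying P.
  Adj : (Fin m → Set) → Fin n → Fin n → Set
  Adj P u v = ∃ λ e → P e × Joins e u v

  adj-sym : ∀ {P u v} → Adj P u v → Adj P v u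
  adj-sym (g , Pg , j) = g , Pg , swap j

  -- Walk P u vs v: the vertices vs are visited in order by a walk from u to v
  -- whose edges satisfy P.
  data Walk (P : Fin m → Set) : Fin n → List (Fin n) → Fin n → Set where
    stop : ∀ {u} → Walk P u [ u ] u
    step : ∀ {u w vs v} → Adj P u w → Walk P w vs v → Walk P u (u ∷ vs) v

  walk-start : ∀ {P u vs v} → Walk P u vs v → u ∈ˡ vs
  walk-start stop       = here refl
  walk-start (step _ _) = here refl

  walk-length : ∀ {P u vs v} → Walk P u vs v → 1 ≤ length vs
  walk-length stop       = s≤s z≤n
  walk-length (step _ _) = s≤s z≤n

  -- A walk without repetitions restarted at one of its vertices.
  walk-from : ∀ {P u vs v x} → Walk P u vs v → Unique vs → x ∈ˡ vs →
              ∃ λ ws → Walk P x ws v × Unique ws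
  walk-from p          uvs       (here refl) with p
  ... | stop      = _ , stop , uvs
  ... | step a p′ = _ , step a p′ , uvs
  walk-from (step _ p) (_ ∷ uvs) (there x∈)  = walk-from p uvs x∈

  simple-path : ∀ {P u v} → Star (Adj P) u v → ∃ λ vs → Walk P u vs v × Unique vs
  simple-path ε = _ , stop , [] ∷ []
  simple-path {u = u} (a ◅ s) with vs , p , uvs ← simple-path s | any? (u ≟_) vs
  ... | yes u∈vs = walk-from p uvs u∈vs
  ... | no  u∉vs = _ , step a p , ¬Any⇒All¬ vs u∉vs ∷ uvs

  walk-preserves : ∀ {P u vs v} {A : Set} (ℓ : Fin n → A) → Walk P u vs v →
    (∀ {g x y} → P g → x ∈ˡ vs → y ∈ˡ vs → Joins g x y → ℓ x ≡ ℓ y) → ℓ u ≡ ℓ v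
  walk-preserves ℓ stop _ = refl
  walk-preserves ℓ (step (g , Pg , j) p) pres =
    trans (pres Pg (here refl) (there (walk-start p)) j)
          (walk-preserves ℓ p λ Ph x∈ y∈ → pres Ph (there x∈) (there y∈))

  -- The consecutive pairs of the sequence w, ws, z. With z = w these are
  -- definitionally the cyclic pairs of w ∷ ws.
  pairs : Fin n → List (Fin n) → Fin n → List (Fin n × Fin n)
  pairs w ws z = zip (w ∷ ws) (ws ∷ʳ z)

  walk-pairs : ∀ {P u u′ vs v z} {R : Fin n × Fin n → Set} → Walk P u (u′ ∷ vs) v →
    (∀ {x y} → Adj P x y → R (x , y)) → R (v , z) → All R (pairs u′ vs z)
  walk-pairs stop                    f r = r ∷ []
  walk-pairs (step a stop)           f r = f a ∷ r ∷ []
  walk-pairs (step a p@(step _ _))   f r = f a ∷ walk-pairs p f r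

  -- The pair that leads from the end v of the walk to z.
  walk-closing : ∀ {P u u′ vs v z} → Walk P u (u′ ∷ vs) v → (v , z) ∈ˡ pairs u′ vs z
  walk-closing stop                  = here refl
  walk-closing (step a stop)         = there (here refl)
  walk-closing (step a p@(step _ _)) = there (walk-closing p)

  -- A closed sequence of at least three distinct vertices, consecutive ones
  -- being adjacent through P, spans a cycle; its edge set is collected here.
  cycle-through : ∀ {P vs} → 3 ≤ length vs → Unique vs →
    All (λ (u , v) → Adj P u v) (cyclicPairs vs) →
    ∃ λ c → IsCycle G c × (∀ {g} → g ∈ c → P g) ×
            (∀ {g u v} → (u , v) ∈ˡ cyclicPairs vs → Joins g u v → g ∈ c)
  cycle-through {P} {vs} 3≤ uvs adj =
    c , (vs , 3≤ , uvs , All.tabulate adj-c , λ e → ∈⟪⟫⁻ on?) , c⊆P , on⇒∈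
    where
    on? : ∀ g → Dec (Any (λ (u , v) → Joins g u v) (cyclicPairs vs))
    on? g = any? (λ (u , v) → joins? G g u v) (cyclicPairs vs)

    c = ⟪ on? ⟫

    on⇒∈ : ∀ {g u v} → (u , v) ∈ˡ cyclicPairs vs → Joins g u v → g ∈ c
    on⇒∈ uv∈ j = ∈⟪⟫⁺ on? (lose uv∈ j)

    adj-c : ∀ {uv} → uv ∈ˡ cyclicPairs vs → AdjacentIn G c (proj₁ uv) (proj₂ uv)
    adj-c uv∈ with g , _ , j ← All.lookup adj uv∈ = g , on⇒∈ uv∈ j , j

    c⊆P : ∀ {g} → g ∈ c → P g
    c⊆P g∈c with find (∈⟪⟫⁻ on? g∈c)
    ... | uv , uv∈ , j with h , Ph , k ← All.lookup adj uv∈ = subst P (simple k j) Ph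

  -- An edge f outside P closes a P-path between its ends to a cycle.
  closing-cycle : ∀ {P f u v} → ¬ P f → Joins f u v → Star (Adj P) u v →
    ∃ λ c → IsCycle G c × (∀ {g} → g ∈ c → P g ⊎ g ≡ f) × f ∈ c
  closing-cycle {P} {f} ¬Pf j s with simple-path s
  ... | _ , stop , _ = contradiction refl (joins-≢ j)
  ... | _ , step (g , Pg , k) stop , _ = contradiction (subst P (simple k j) Pg) ¬Pf
  ... | _ , p@(step _ (step _ q)) , uvs
    with c , cyc , c⊆ , on⇒∈ ← cycle-through (s≤s (s≤s (walk-length q))) uvs
           (walk-pairs {R = λ (x , y) → Adj (λ g → P g ⊎ g ≡ f) x y} p
             (λ (g , Pg , k) → g , inj₁ Pg , k) (f , inj₂ refl , swap j)) =
    c , cyc , c⊆ , on⇒∈ (walk-closing p) (swap j)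

  pairs-first : ∀ {a b w ws z} → (a , b) ∈ˡ pairs w ws z → a ∈ˡ (w ∷ ws)
  pairs-first {ws = []}    (here refl) = here refl
  pairs-first {ws = _ ∷ _} (here refl) = here refl
  pairs-first {ws = _ ∷ _} (there ab∈) = there (pairs-first ab∈)

  -- An edge joining the first pair (w , y) of the sequence w, y, ws, z joins no
  -- later pair. Only the last vertex z may equal w; then ws must be non-empty,
  -- as w, y, w would traverse the edge twice.
  no-repeat : ∀ {f w y ws z a b} → Unique (w ∷ y ∷ ws) → 1 ≤ length ws ⊎ z ≢ w →
    Joins f w y → (a , b) ∈ˡ pairs y ws z → ¬ Joins f a b
  no-repeat {y = y} {ws} {z} (w∉ ∷ (y∉ ∷ _)) ok j ab∈ k with joins-ends j k
  ... | inj₁ (refl , _)    = All¬⇒¬Any w∉ (pairs-first ab∈)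
  ... | inj₂ (refl , refl) = second ws w∉ y∉ ok ab∈
    where
    second : ∀ {w} ws → All (w ≢_) (y ∷ ws) → All (y ≢_) ws → 1 ≤ length ws ⊎ z ≢ w →
             ¬ ((y , w) ∈ˡ pairs y ws z)
    second []       _  _  (inj₂ z≢w) (here refl)    = z≢w refl
    second (_ ∷ _) (_ ∷ w≢ ∷ _) _ _ (here refl)     = w≢ refl
    second (_ ∷ _)  _  y∉ _ (there ab∈)             = All¬⇒¬Any y∉ (pairs-first ab∈)

  module _ {A : Set} (ℓ : Fin n → A) {c f}
    (pres : ∀ {g x y} → g ∈ c → g ≢ f → Joins g x y → ℓ x ≡ ℓ y) where

    -- A sequence whose pairs are not joined by f stays on one label.
    avoiding-preserves : ∀ w ws z → All (λ (x , y) → AdjacentIn G c x y) (pairs w ws z) →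
      (∀ {a b} → (a , b) ∈ˡ pairs w ws z → ¬ Joins f a b) → ℓ w ≡ ℓ z
    avoiding-preserves w [] z ((g , g∈c , j) ∷ []) ¬f =
      pres g∈c (λ { refl → ¬f (here refl) j }) j
    avoiding-preserves w (y ∷ ws) z ((g , g∈c , j) ∷ adj) ¬f =
      trans (pres g∈c (λ { refl → ¬f (here refl) j }) j)
            (avoiding-preserves y ws z adj (¬f ∘ there))

    private
      shorten : ∀ {k} {B : Set} → 2 ≤ suc k ⊎ B → 1 ≤ k ⊎ B
      shorten (inj₁ 2≤) = inj₁ (s≤s⁻¹ 2≤)
      shorten (inj₂ b)  = inj₂ b

    -- If the sequence w, ws, z passes through f and both its ends have the same
    -- label, so have the ends of f: by no-repeat, f is traversed only once.
    preserved-along : ∀ w ws z → Unique (w ∷ ws) → z ∉ˡ ws → 2 ≤ length ws ⊎ z ≢ w →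
      All (λ (x , y) → AdjacentIn G c x y) (pairs w ws z) →
      Any (λ (x , y) → Joins f x y) (pairs w ws z) → ℓ w ≡ ℓ z →
      ∃₂ λ u v → Joins f u v × ℓ u ≡ ℓ v
    preserved-along w [] z _ _ _ _ (here j) w≡z = w , z , j , w≡z
    preserved-along w (y ∷ ws) z uws z∉ ok (a ∷ adj) (here j) w≡z =
      w , y , j , trans w≡z (sym (avoiding-preserves y ws z adj (no-repeat uws (shorten ok) j)))
    preserved-along w (y ∷ ws) z uws@(_ ∷ uws′) z∉ ok ((g , g∈c , k) ∷ adj) (there on) w≡z =
      preserved-along y ws z uws′ (z∉ ∘ there) (inj₂ (z∉ ∘ here)) adj on
        (trans (sym (pres g∈c g≢f k)) w≡z)
      where
      g≢f : g ≢ f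
      g≢f refl with find on
      ... | _ , ab∈ , j = no-repeat uws (shorten ok) k ab∈ j

    -- A vertex labelling cannot change along exactly one edge of a cycle.
    cycle-preserves : IsCycle G c → f ∈ c → ∀ {u v} → Joins f u v → ℓ u ≡ ℓ v
    cycle-preserves (x ∷ xs , 3≤ , uvs@(x∉ ∷ _) , adj , on) f∈c j
      with preserved-along x xs x uvs (All¬⇒¬Any x∉) (inj₁ (s≤s⁻¹ 3≤)) adj (on _ f∈c) refl
    ... | u , v , k , u≡v with joins-ends j k
    ...   | inj₁ (refl , refl) = u≡v
    ...   | inj₂ (refl , refl) = sym u≡v

  -- The edges of the first three steps of the cycle.
  three-edges : ∀ {c} → IsCycle G c → ∃ λ g₁ → ∃ λ g₂ → ∃ λ g₃ →
    (g₁ ∈ c × g₂ ∈ c × g₃ ∈ c) × g₁ ≢ g₂ × g₁ ≢ g₃ × g₂ ≢ g₃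
  three-edges (_ ∷ [] , s≤s () , _)
  three-edges (_ ∷ _ ∷ [] , s≤s (s≤s ()) , _)
  three-edges (x ∷ y ∷ z ∷ [] , _ , ((x≢y ∷ x≢z ∷ []) ∷ (y≢z ∷ []) ∷ _) ,
               (g₁ , ∈₁ , j₁) ∷ (g₂ , ∈₂ , j₂) ∷ (g₃ , ∈₃ , j₃) ∷ _ , _) =
    g₁ , g₂ , g₃ , (∈₁ , ∈₂ , ∈₃) , edges-differ j₁ j₂ x≢y x≢z ,
    ≢-sym (edges-differ j₃ j₁ (≢-sym x≢z) (≢-sym y≢z)) , edges-differ j₂ j₃ y≢z (≢-sym x≢y)
  three-edges (x ∷ y ∷ z ∷ w ∷ _ , _ , ((x≢y ∷ x≢z ∷ _) ∷ (y≢z ∷ y≢w ∷ _) ∷ _) ,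
               (g₁ , ∈₁ , j₁) ∷ (g₂ , ∈₂ , j₂) ∷ (g₃ , ∈₃ , j₃) ∷ _ , _) =
    g₁ , g₂ , g₃ , (∈₁ , ∈₂ , ∈₃) , edges-differ j₁ j₂ x≢y x≢z ,
    ≢-sym (edges-differ j₃ j₁ (≢-sym x≢z) (≢-sym y≢z)) , edges-differ j₂ j₃ y≢z y≢w

  -- Cuts of a tree and its tree-cycles

  -- ℓ tells on which side of the tree edge d of T a vertex lies: among the
  -- edges of T, exactly d changes ℓ.
  record Cut (T : Subset m) (d : Fin m) (ℓ : Fin n → Bool) : Set where
    field
      separates : ∀ {x y} → Joins d x y → ℓ x ≢ ℓ y
      preserves : ∀ {g x y} → g ∈ T → g ≢ d → Joins g x y → ℓ x ≡ ℓ y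

  open Cut

  cut-exists : ∀ {T d} → IsSpanningTree G T → d ∈ T → ∃ (Cut T d)
  cut-exists {T} {d} (connected , acyclic) d∈T with p , q , j ← joins-ends-of d =
    ℓ , record { separates = sep ; preserves = λ g∈T g≢d k → pres (_ , (g∈T , g≢d) , k) }
    where
    T-d : Fin m → Set
    T-d g = g ∈ T × g ≢ d

    -- Follow a path from x to p until it first uses d.
    side : ∀ {x} → Star (AdjacentIn G T) x p → Star (Adj T-d) x p ⊎ Star (Adj T-d) x q
    side ε = inj₁ ε
    side ((g , g∈T , k) ◅ s) with g ≟ d
    ... | yes refl with joins-ends k j
    ...   | inj₁ (refl , _) = inj₁ ε
    ...   | inj₂ (refl , _) = inj₂ ε
    side ((g , g∈T , k) ◅ s) | no g≢d with side s
    ...   | inj₁ s′ = inj₁ ((g , (g∈T , g≢d) , k) ◅ s′)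
    ...   | inj₂ s′ = inj₂ ((g , (g∈T , g≢d) , k) ◅ s′)

    ℓ : Fin n → Bool
    ℓ x = [ const true , const false ]′ (side (connected x p))

    -- A path from p to q avoiding d would close with d to a cycle inside T.
    apart : ∀ {x} → Star (Adj T-d) x p → ¬ Star (Adj T-d) x q
    apart s t with c , cyc , c⊆ , _ ←
      closing-cycle (λ (_ , d≢d) → d≢d refl) j (reverse adj-sym s ◅◅ t) =
      acyclic c (λ g∈c → [ proj₁ , (λ { refl → d∈T }) ]′ (c⊆ g∈c)) cyc

    on-p : ∀ {x} → Star (Adj T-d) x p → ℓ x ≡ true
    on-p {x} s with side (connected x p)
    ... | inj₁ _ = refl
    ... | inj₂ t = contradiction t (apart s)

    on-q : ∀ {x} → Star (Adj T-d) x q → ℓ x ≡ false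
    on-q {x} t with side (connected x p)
    ... | inj₁ s = contradiction t (apart s)
    ... | inj₂ _ = refl

    sep : ∀ {x y} → Joins d x y → ℓ x ≢ ℓ y
    sep k ℓ≡ with trans (sym (on-p ε)) (trans ℓp≡ℓq (on-q ε))
      where
      ℓp≡ℓq : ℓ p ≡ ℓ q
      ℓp≡ℓq with joins-ends k j
      ... | inj₁ (refl , refl) = ℓ≡
      ... | inj₂ (refl , refl) = sym ℓ≡
    ... | ()

    pres : ∀ {x y} → Adj T-d x y → ℓ x ≡ ℓ y
    pres {x} {y} a with side (connected x p)
    ... | inj₁ s = sym (on-p (adj-sym a ◅ s))
    ... | inj₂ t = sym (on-q (adj-sym a ◅ t))

  -- c is a tree-cycle of T induced by the cycle-edge e.
  TreeCycle : Subset m → Fin m → Subset m → Set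
  TreeCycle T e c = e ∉ T × c ⊆ T ∪ ⁅ e ⁆ × IsCycle G c

  tree-cycle-edge : ∀ {T e c g} → TreeCycle T e c → g ∈ c → g ∈ T ⊎ g ≡ e
  tree-cycle-edge {T} {e} (_ , c⊆ , _) g∈c with x∈p∪q⁻ T ⁅ e ⁆ (c⊆ g∈c)
  ... | inj₁ g∈T = inj₁ g∈T
  ... | inj₂ g∈e = inj₂ (x∈⁅y⁆⇒x≡y e g∈e)

  chord-unique : ∀ {T e c f} → TreeCycle T e c → f ∈ c → f ∉ T → f ≡ e
  chord-unique tc f∈c f∉T = [ (λ f∈T → contradiction f∈T f∉T) , (λ f≡e → f≡e) ]′
                              (tree-cycle-edge tc f∈c)

  chord∈ : ∀ {T e c} → IsAcyclic G T → TreeCycle T e c → e ∈ c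
  chord∈ {T} {e} {c} acyclic tc@(_ , _ , cyc) with e ∈? c
  ... | yes e∈c = e∈c
  ... | no  e∉c = contradiction cyc (acyclic c λ g∈c →
    [ (λ g∈T → g∈T) , (λ { refl → contradiction g∈c e∉c }) ]′ (tree-cycle-edge tc g∈c))

  chord-injective : ∀ {T e e′ c} → IsAcyclic G T →
    TreeCycle T e c → TreeCycle T e′ c → e ≡ e′
  chord-injective acyclic tc tc′ = chord-unique tc′ (chord∈ acyclic tc) (proj₁ tc)

  tree-cycle-exists : ∀ {T e} → IsConnected G T → e ∉ T → ∃ (TreeCycle T e)
  tree-cycle-exists {T} {e} connected e∉T
    with u , v , j ← joins-ends-of e
    with c , cyc , c⊆ , _ ← closing-cycle e∉T j (connected u v) =
    c , e∉T , (λ g∈c → x∈p∪q⁺ ([ inj₁ , (λ { refl → inj₂ (x∈⁅x⁆ e) }) ]′ (c⊆ g∈c))) , cyc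

  module _ {T e c d ℓ u v} (tc : TreeCycle T e c) (cut : Cut T d ℓ) (j : Joins e u v) where

    -- Otherwise d would be the only edge of c changing ℓ.
    ∈⇒crossing : d ∈ T → d ∈ c → ℓ u ≢ ℓ v
    ∈⇒crossing d∈T d∈c ℓu≡ℓv with x , y , k ← joins-ends-of d =
      separates cut k (cycle-preserves ℓ pres (proj₂ (proj₂ tc)) d∈c k)
      where
      pres : ∀ {g x y} → g ∈ c → g ≢ d → Joins g x y → ℓ x ≡ ℓ y
      pres g∈c g≢d k with tree-cycle-edge tc g∈c
      ... | inj₁ g∈T = preserves cut g∈T g≢d k
      ... | inj₂ refl with joins-ends k j
      ...   | inj₁ (refl , refl) = ℓu≡ℓv
      ...   | inj₂ (refl , refl) = sym ℓu≡ℓv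

    -- Otherwise e would be the only edge of c changing ℓ.
    crossing⇒∈ : IsAcyclic G T → ℓ u ≢ ℓ v → d ∈ c
    crossing⇒∈ acyclic ℓu≢ℓv with d ∈? c
    ... | yes d∈c = d∈c
    ... | no  d∉c = contradiction
      (cycle-preserves ℓ pres (proj₂ (proj₂ tc)) (chord∈ acyclic tc) j) ℓu≢ℓv
      where
      pres : ∀ {g x y} → g ∈ c → g ≢ e → Joins g x y → ℓ x ≡ ℓ y
      pres g∈c g≢e k with tree-cycle-edge tc g∈c
      ... | inj₁ g∈T = preserves cut g∈T (λ { refl → d∉c g∈c }) k
      ... | inj₂ g≡e = contradiction g≡e g≢e

  tree-cycle-unique : ∀ {T e c c′} → IsSpanningTree G T →
    TreeCycle T e c → TreeCycle T e c′ → c ≡ c′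
  tree-cycle-unique {T} {e} tree@(_ , acyclic) tc tc′ =
    ⊆-antisym (within tc tc′) (within tc′ tc)
    where
    within : ∀ {c c′} → TreeCycle T e c → TreeCycle T e c′ → c ⊆ c′
    within tc tc′ {g} g∈c with tree-cycle-edge tc g∈c
    ... | inj₂ refl = chord∈ acyclic tc′
    ... | inj₁ g∈T with _ , cut ← cut-exists tree g∈T | _ , _ , j ← joins-ends-of e =
      crossing⇒∈ tc′ cut j acyclic (∈⇒crossing tc cut j g∈T g∈c)

  -- Counting tree-cycles

  -- The edges of T, and the edges outside T (the cycle-edges).
  treeEdges chords : Subset m → List (Fin m)
  treeEdges T = filter (_∈? T) (allFin m)
  chords T = filter (λ e → ¬? (e ∈? T)) (allFin m)

  treeEdges-unique : ∀ T → Unique (treeEdges T)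
  treeEdges-unique T = Unique.filter⁺ _ (Unique.allFin⁺ m)

  chords-unique : ∀ T → Unique (chords T)
  chords-unique T = Unique.filter⁺ _ (Unique.allFin⁺ m)

  treeCycles-unique : ∀ T → Unique (treeCycles G T)
  treeCycles-unique T = Unique.filter⁺ _ (subsets-unique m)

  ∈-treeCycles⁺ : ∀ {T e c} → TreeCycle T e c → c ∈ˡ treeCycles G T
  ∈-treeCycles⁺ tc = ∈-filter⁺ _ (∈-subsets _) (_ , tc)

  ∈-treeCycles⁻ : ∀ {T c} → c ∈ˡ treeCycles G T → ∃ λ e → TreeCycle T e c
  ∈-treeCycles⁻ {T} c∈ = proj₂ (∈-filter⁻ (isTreeCycle? G T) {xs = subsets m} c∈)

  meets? : ∀ T c → Decidable (λ c′ → c′ ≢ c × Nonempty (intersection G T c c′))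
  meets? T c c′ = ¬? (c′ ≟ˢ c) ×-dec nonempty? (intersection G T c c′)

  -- The tree-cycles counted by the cycle intersection number of c.
  meeting : Subset m → Subset m → List (Subset m)
  meeting T c = filter (meets? T c) (treeCycles G T)

  chords≤treeCycles : ∀ {T} → IsSpanningTree G T →
    length (chords T) ≤ length (treeCycles G T)
  chords≤treeCycles {T} (connected , acyclic) =
    length≤-by (TreeCycle T)
      (chord-injective acyclic) (chords-unique T) total
    where
    total : ∀ {e} → e ∈ˡ chords T → ∃ λ c → c ∈ˡ treeCycles G T × TreeCycle T e c
    total e∈ with c , tc ← tree-cycle-exists connected (proj₂ (∈-filter⁻ _ {xs = allFin m} e∈)) =
      c , ∈-treeCycles⁺ tc , tc

  treeCycles≤chords : ∀ {T} → IsSpanningTree G T →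
    length (treeCycles G T) ≤ length (chords T)
  treeCycles≤chords {T} tree =
    length≤-by (λ c e → TreeCycle T e c) (tree-cycle-unique tree) (treeCycles-unique T) total
    where
    total : ∀ {c} → c ∈ˡ treeCycles G T → ∃ λ e → e ∈ˡ chords T × TreeCycle T e c
    total c∈ with e , tc@(e∉T , _) ← ∈-treeCycles⁻ c∈ = e , ∈-filter⁺ _ (∈-allFin e) e∉T , tc

  -- z is the end of the tree edge d that is farther from s: the one that the cut
  -- of d separates from s.
  FarEnd : Subset m → Fin n → Fin m → Fin n → Set
  FarEnd T s d z =
    d ∈ T × (∃ λ x → Joins d z x) × ∃ λ ℓ → Cut T d ℓ × ℓ z ≢ ℓ s

  far-end-exists : ∀ {T s d} → IsSpanningTree G T → d ∈ T → ∃ (FarEnd T s d)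
  far-end-exists {s = s} {d} tree d∈T
    with ℓ , cut ← cut-exists tree d∈T | x , y , j ← joins-ends-of d | ℓ x ≟ᵇ ℓ s
  ... | no ℓx≢ℓs  = x , d∈T , (y , j) , ℓ , cut , ℓx≢ℓs
  ... | yes ℓx≡ℓs = y , d∈T , (x , swap j) , ℓ , cut ,
                    λ ℓy≡ℓs → separates cut j (trans ℓx≡ℓs (sym ℓy≡ℓs))

  -- Both edges are the first edge of the path in T from z to s: the rest of
  -- the path avoids z, hence stays on one side of either edge.
  far-end-injective : ∀ {T s d d′ z} → IsConnected G T →
    FarEnd T s d z → FarEnd T s d′ z → d ≡ d′
  far-end-injective {T} {s} {z = z} connected far far′ with simple-path (connected z s)
  ... | _ , stop , _ with _ , _ , _ , _ , ℓ≢ ← far = contradiction refl ℓ≢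
  ... | _ , step {w = w} {vs} (g , g∈T , k) p , (z∉ ∷ _) = trans (sym (first far)) (first far′)
    where
    first : ∀ {d} → FarEnd T s d z → g ≡ d
    first {d} (_ , (x , j) , ℓ , cut , ℓz≢ℓs) with g ≟ d
    ... | yes g≡d = g≡d
    ... | no  g≢d = contradiction
      (trans (preserves cut g∈T g≢d k) (walk-preserves ℓ p rest)) ℓz≢ℓs
      where
      rest : ∀ {h a b} → h ∈ T → a ∈ˡ vs → b ∈ˡ vs → Joins h a b → ℓ a ≡ ℓ b
      rest h∈T a∈ b∈ i = preserves cut h∈T (≢-sym (edges-differ j i
        (All.lookup z∉ a∈) (All.lookup z∉ b∈))) i

  module _ {T Tₛ} (tree : IsSpanningTree G T) (star : IsStarSpanningTree G Tₛ) where

    private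
      s = proj₁ (proj₂ star)

    treeEdges≤star : length (treeEdges T) ≤ length (treeEdges Tₛ)
    treeEdges≤star = length≤-by (λ d g → ∃ λ z → FarEnd T s d z × Joins g s z)
      inj (treeEdges-unique T) total
      where
      inj : ∀ {d d′ g} → (∃ λ z → FarEnd T s d z × Joins g s z) →
            (∃ λ z → FarEnd T s d′ z × Joins g s z) → d ≡ d′
      inj (_ , far , j) (_ , far′ , j′) with refl ← joins-other j j′ =
        far-end-injective (proj₁ tree) far far′

      total : ∀ {d} → d ∈ˡ treeEdges T →
              ∃ λ g → g ∈ˡ treeEdges Tₛ × ∃ λ z → FarEnd T s d z × Joins g s z
      total d∈
        with z , far@(_ , _ , ℓ , _ , ℓz≢ℓs) ←
               far-end-exists tree (proj₂ (∈-filter⁻ (_∈? T) {xs = allFin m} d∈))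
        with g , g∈Tₛ , j ← proj₂ (proj₂ star) z (λ z≡s → ℓz≢ℓs (cong ℓ z≡s)) =
        g , ∈-filter⁺ _ (∈-allFin g) g∈Tₛ , z , far , j

    star-treeCycles≤ : length (treeCycles G Tₛ) ≤ length (treeCycles G T)
    star-treeCycles≤ = begin
      length (treeCycles G Tₛ) ≤⟨ treeCycles≤chords (proj₁ star) ⟩
      length (chords Tₛ)       ≤⟨ +-cancelˡ-≤ (length (treeEdges T)) _ _ complement ⟩
      length (chords T)        ≤⟨ chords≤treeCycles tree ⟩
      length (treeCycles G T)  ∎
      where
      open ≤-Reasoning
      complement : length (treeEdges T) + length (chords Tₛ) ≤
                   length (treeEdges T) + length (chords T)
      complement = begin
        length (treeEdges T) + length (chords Tₛ)  ≤⟨ +-monoˡ-≤ _ treeEdges≤star ⟩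
        length (treeEdges Tₛ) + length (chords Tₛ) ≡⟨ length-filter-¬ (_∈? Tₛ) (allFin m) ⟩
        length (allFin m)                          ≡⟨ length-filter-¬ (_∈? T) (allFin m) ⟨
        length (treeEdges T) + length (chords T)   ∎

  -- Tree-cycles of a star

  module _ {T} (star : IsStarSpanningTree G T) where

    private
      tree    = proj₁ star
      acyclic = proj₂ (proj₁ star)
      s       = proj₁ (proj₂ star)
      spoke   = proj₂ (proj₂ star)

    -- An edge of T missing the centre would form a triangle with two spokes.
    star-edge : ∀ {g} → g ∈ T → ∃ λ v → Joins g s v
    star-edge {g} g∈T with x , y , j ← joins-ends-of g | x ≟ s | y ≟ s
    ... | yes refl | _        = y , j
    ... | no _     | yes refl = x , swap j
    ... | no x≢s   | no y≢s
      with c , cyc , c⊆T , _ ← cycle-through {P = _∈ T} (s≤s (s≤s (s≤s z≤n)))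
             ((≢-sym x≢s ∷ ≢-sym y≢s ∷ []) ∷ (joins-≢ j ∷ []) ∷ [] ∷ [])
             (spoke x x≢s ∷ (g , g∈T , j) ∷ adj-sym (spoke y y≢s) ∷ [])
      = contradiction cyc (acyclic c c⊆T)

    chord-misses-centre : ∀ {e u v} → e ∉ T → Joins e u v → u ≢ s
    chord-misses-centre e∉T j refl with g , g∈T , k ← spoke _ (≢-sym (joins-≢ j))
      with refl ← simple j k = e∉T g∈T

    -- The cut of the spoke at v separates the leaf v from all other vertices.
    star-cut : ∀ {d v} → Joins d s v → Cut T d (λ x → does (x ≟ v))
    star-cut {d} {v} j = record { separates = sep ; preserves = pres }
      where
      sep : ∀ {x y} → Joins d x y → does (x ≟ v) ≢ does (y ≟ v)
      sep k eq with joins-ends j k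
      ... | inj₁ (refl , refl)
        with () ← trans (sym (dec-false (s ≟ v) (joins-≢ j))) (trans eq (dec-true (v ≟ v) refl))
      ... | inj₂ (refl , refl)
        with () ← trans (sym (dec-true (v ≟ v) refl)) (trans eq (dec-false (s ≟ v) (joins-≢ j)))

      pres : ∀ {g x y} → g ∈ T → g ≢ d → Joins g x y → does (x ≟ v) ≡ does (y ≟ v)
      pres {x = x} {y} g∈T g≢d k with w , i ← star-edge g∈T =
        trans (dec-false (x ≟ v) (off k)) (sym (dec-false (y ≟ v) (off (swap k))))
        where
        off : ∀ {x y} → Joins _ x y → x ≢ v
        off k refl with joins-ends i k
        ... | inj₁ (s≡v , _)  = joins-≢ j s≡v
        ... | inj₂ (_ , refl) = g≢d (simple i j)

    -- The tree edges of the tree-cycle of a cycle-edge e are spokes at an end of e.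
    spoke-of-cycle : ∀ {e c d a b} → TreeCycle T e c → Joins e a b → d ∈ T → d ∈ c →
                     ∃ λ v → Joins d s v × (v ≡ a ⊎ v ≡ b)
    spoke-of-cycle {a = a} {b} tc j d∈T d∈c with v , k ← star-edge d∈T | a ≟ v | b ≟ v
    ... | yes refl | _        = v , k , inj₁ refl
    ... | no _     | yes refl = v , k , inj₂ refl
    ... | no a≢v   | no b≢v   = contradiction
      (trans (dec-false (a ≟ v) a≢v) (sym (dec-false (b ≟ v) b≢v)))
      (∈⇒crossing tc (star-cut k) j d∈T d∈c)

    star-meets-≤ : ∀ {c} → c ∈ˡ treeCycles G T →
                   cycleIntersectionNumber G T c ≤ (n ∸ 3) * 2
    star-meets-≤ {c} c∈
      with e , tc ← ∈-treeCycles⁻ c∈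
      with a , b , j ← joins-ends-of e = begin
      cycleIntersectionNumber G T c
        ≤⟨ length≤-by R inj (Unique.filter⁺ (meets? T c) (treeCycles-unique T)) total ⟩
      length (cartesianProduct (others s a b) (a ∷ b ∷ []))
        ≡⟨ length-cartesianProduct₂ (others s a b) ⟩
      length (others s a b) * 2
        ≤⟨ *-monoˡ-≤ 2 (others-≤ s a b (≢-sym (chord-misses-centre (proj₁ tc) j))
             (≢-sym (chord-misses-centre (proj₁ tc) (swap j))) (joins-≢ j)) ⟩
      (n ∸ 3) * 2 ∎
      where
      open ≤-Reasoning

      -- (x , v) records the cycle-edge v x of c′, where v is an end of e.
      R : Subset m → Fin n × Fin n → Set
      R c′ (x , v) = ∃ λ e′ → TreeCycle T e′ c′ × Joins e′ v x

      inj : ∀ {c₁ c₂ xv} → R c₁ xv → R c₂ xv → c₁ ≡ c₂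
      inj (_ , tc₁ , j₁) (_ , tc₂ , j₂) with refl ← simple j₁ j₂ = tree-cycle-unique tree tc₁ tc₂

      total : ∀ {c′} → c′ ∈ˡ meeting T c →
              ∃ λ xv → xv ∈ˡ cartesianProduct (others s a b) (a ∷ b ∷ []) × R c′ xv
      total {c′} c′∈
        with c′∈′ , c′≢c , d , d∈ ← ∈-filter⁻ (meets? T c) {xs = treeCycles G T} c′∈
        with d∈T , d∈cc′ ← x∈p∩q⁻ T (c ∩ c′) d∈
        with d∈c , d∈c′ ← x∈p∩q⁻ c c′ d∈cc′
        with e′ , tc′ ← ∈-treeCycles⁻ c′∈′
        with a′ , b′ , j′ ← joins-ends-of e′
        with v , k , v∈e ← spoke-of-cycle tc j d∈T d∈c
        with v′ , k′ , v∈e′ ← spoke-of-cycle tc′ j′ d∈T d∈c′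
        with refl ← joins-other k k′
        with x , i ← other-end j′ v∈e′ =
        (x , v) , ∈-cartesianProduct⁺ (∈-others⁺ s a b (fresh v∈e i)) (∈ab v∈e) , e′ , tc′ , i
        where
        ∈ab : ∀ {v} → v ≡ a ⊎ v ≡ b → v ∈ˡ (a ∷ b ∷ [])
        ∈ab (inj₁ refl) = here refl
        ∈ab (inj₂ refl) = there (here refl)

        e′≢e : e′ ≢ e
        e′≢e refl = c′≢c (tree-cycle-unique tree tc′ tc)

        fresh : ∀ {v x} → v ≡ a ⊎ v ≡ b → Joins e′ v x → x ∉ˡ (s ∷ a ∷ b ∷ [])
        fresh _ i (here refl) = chord-misses-centre (proj₁ tc′) (swap i) refl
        fresh (inj₁ refl) i (there (here refl))         = joins-≢ i refl
        fresh (inj₂ refl) i (there (here refl))         = e′≢e (simple i (swap j))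
        fresh (inj₁ refl) i (there (there (here refl))) = e′≢e (simple i j)
        fresh (inj₂ refl) i (there (there (here refl))) = joins-≢ i refl

  -- Edges across a labelling with three values

  module _ (complete : IsComplete G) {A : Set} (_≟ᴬ_ : DecidableEquality A) (ℓ : Fin n → A)
    {α β γ} (α≢β : ℓ α ≢ ℓ β) (α≢γ : ℓ α ≢ ℓ γ) (β≢γ : ℓ β ≢ ℓ γ) where

    -- g joins two differently labelled vertices from the list vs.
    Crossing : List (Fin n) → Fin m → Set
    Crossing vs g = ∃₂ λ u v → Joins g u v × ℓ u ≢ ℓ v × u ∈ˡ vs × v ∈ˡ vs

    -- Representatives of three labels; further labels may occur.
    reps : List (Fin n)
    reps = α ∷ β ∷ γ ∷ []

    crossing-edge : ∀ {u v} → ℓ u ≢ ℓ v → ∃ λ g → Joins g u v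
    crossing-edge ℓ≢ = complete λ u≡v → ℓ≢ (cong ℓ u≡v)

    -- The label of x is that of at most one representative.
    two-partners : ∀ x → ∃₂ λ y z → y ≢ z × (ℓ x ≢ ℓ y × y ∈ˡ reps) × (ℓ x ≢ ℓ z × z ∈ˡ reps)
    two-partners x with ℓ x ≟ᴬ ℓ α | ℓ x ≟ᴬ ℓ β
    ... | yes x≡α | _ = β , γ , (λ { refl → β≢γ refl }) ,
      ((λ x≡β → α≢β (trans (sym x≡α) x≡β)) , there (here refl)) ,
      ((λ x≡γ → α≢γ (trans (sym x≡α) x≡γ)) , there (there (here refl)))
    ... | no x≢α  | yes x≡β = α , γ , (λ { refl → α≢γ refl }) , (x≢α , here refl) ,
      ((λ x≡γ → β≢γ (trans (sym x≡β) x≡γ)) , there (there (here refl)))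
    ... | no x≢α  | no x≢β = α , β , (λ { refl → α≢β refl }) , (x≢α , here refl) ,
      (x≢β , there (here refl))

    -- The edges between representatives, and two edges from each vertex of xs to
    -- representatives. That all edges found so far have their ends in the current
    -- vertex list is what makes the edges at a further vertex new.
    crossing-edges : ∀ xs → Unique xs → (∀ {x} → x ∈ˡ xs → x ∉ˡ reps) →
      ∃ λ gs → Unique gs × All (Crossing (reps ++ xs)) gs × length gs ≡ 3 + length xs * 2
    crossing-edges [] _ _
      with g , jg ← crossing-edge α≢β | h , jh ← crossing-edge α≢γ | k , jk ← crossing-edge β≢γ =
      g ∷ h ∷ k ∷ [] ,
      (≢-sym (edges-differ (swap jh) jg (λ { refl → α≢γ refl }) (λ { refl → β≢γ refl })) ∷
       edges-differ jg jk (λ { refl → α≢β refl }) (λ { refl → α≢γ refl }) ∷ []) ∷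
      (edges-differ jh jk (λ { refl → α≢β refl }) (λ { refl → α≢γ refl }) ∷ []) ∷ [] ∷ [] ,
      (_ , _ , jg , α≢β , here refl , there (here refl)) ∷
      (_ , _ , jh , α≢γ , here refl , there (there (here refl))) ∷
      (_ , _ , jk , β≢γ , there (here refl) , there (there (here refl))) ∷ [] , refl
    crossing-edges (x ∷ xs) (x∉xs ∷ uxs) fresh
      with gs , ugs , cross , len ← crossing-edges xs uxs (fresh ∘ there)
      with y , z , y≢z , (x≢y , y∈) , (x≢z , z∈) ← two-partners x
      with g , jg ← crossing-edge x≢y | h , jh ← crossing-edge x≢z =
      g ∷ h ∷ gs ,
      (g≢h ∷ All.map (new jg) cross) ∷ All.map (new jh) cross ∷ ugs ,
      (x , y , jg , x≢y , x∈ , ∈-++⁺ˡ y∈) ∷ (x , z , jh , x≢z , x∈ , ∈-++⁺ˡ z∈) ∷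
        All.map weaken cross ,
      cong (2 +_) len
      where
      x∈ : x ∈ˡ (reps ++ x ∷ xs)
      x∈ = ∈-++⁺ʳ reps (here refl)

      g≢h : g ≢ h
      g≢h refl = y≢z (joins-other jg jh)

      x∉ : x ∉ˡ (reps ++ xs)
      x∉ p with ∈-++⁻ reps p
      ... | inj₁ q = fresh (here refl) q
      ... | inj₂ q = All¬⇒¬Any x∉xs q

      new : ∀ {g h w} → Joins g x w → Crossing (reps ++ xs) h → g ≢ h
      new j (u , v , k , _ , u∈ , v∈) =
        edges-differ j k (λ { refl → x∉ u∈ }) (λ { refl → x∉ v∈ })

      widen : ∀ {v} → v ∈ˡ (reps ++ xs) → v ∈ˡ (reps ++ x ∷ xs)
      widen p = [ ∈-++⁺ˡ , (λ q → ∈-++⁺ʳ reps (there q)) ]′ (∈-++⁻ reps p)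

      weaken : ∀ {h} → Crossing (reps ++ xs) h → Crossing (reps ++ x ∷ xs) h
      weaken (u , v , k , u≢v , u∈ , v∈) = u , v , k , u≢v , widen u∈ , widen v∈

  -- Tree-cycles meeting a given one

  -- At most one of three edges of c is the cycle-edge.
  two-tree-edges : ∀ {T e c} → TreeCycle T e c →
                   ∃₂ λ d₁ d₂ → d₁ ≢ d₂ × (d₁ ∈ T × d₁ ∈ c) × (d₂ ∈ T × d₂ ∈ c)
  two-tree-edges tc@(_ , _ , cyc)
    with g₁ , g₂ , g₃ , (∈₁ , ∈₂ , ∈₃) , 1≢2 , 1≢3 , 2≢3 ← three-edges cyc
    with tree-cycle-edge tc ∈₁ | tree-cycle-edge tc ∈₂ | tree-cycle-edge tc ∈₃
  ... | inj₁ t₁   | inj₁ t₂   | _         = g₁ , g₂ , 1≢2 , (t₁ , ∈₁) , (t₂ , ∈₂)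
  ... | inj₁ t₁   | inj₂ _    | inj₁ t₃   = g₁ , g₃ , 1≢3 , (t₁ , ∈₁) , (t₃ , ∈₃)
  ... | inj₂ _    | inj₁ t₂   | inj₁ t₃   = g₂ , g₃ , 2≢3 , (t₂ , ∈₂) , (t₃ , ∈₃)
  ... | inj₂ refl | inj₂ refl | _         = contradiction refl 1≢2
  ... | inj₂ refl | inj₁ _    | inj₂ refl = contradiction refl 1≢3
  ... | inj₁ _    | inj₂ refl | inj₂ refl = contradiction refl 2≢3

  _≟ᴸ_ : DecidableEquality (Bool × Bool)
  _≟ᴸ_ = ≡-dec _≟ᵇ_ _≟ᵇ_

  -- Two cuts through different edges label the vertices with at least three
  -- values: the ends of d₁ have the same second label, and one end of d₂ has the
  -- other one.
  three-labels : ∀ {T d₁ d₂ ℓ₁ ℓ₂} → d₁ ∈ T → d₂ ∈ T → d₁ ≢ d₂ → Cut T d₁ ℓ₁ → Cut T d₂ ℓ₂ →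
    let ℓ = λ x → ℓ₁ x , ℓ₂ x in
    ∃ λ α → ∃ λ β → ∃ λ γ → ℓ α ≢ ℓ β × ℓ α ≢ ℓ γ × ℓ β ≢ ℓ γ
  three-labels {d₁ = d₁} {d₂} {ℓ₁} {ℓ₂} d₁∈T d₂∈T d₁≢d₂ cut₁ cut₂
    with p , q , j ← joins-ends-of d₁ | r , t , k ← joins-ends-of d₂
    with ℓ₂p≡ℓ₂q ← preserves cut₂ d₁∈T d₁≢d₂ j
    with ℓ₂ p ≟ᵇ ℓ₂ r
  ... | no p≢r = p , q , r , separates cut₁ j ∘ cong proj₁ , p≢r ∘ cong proj₂ ,
                 λ q≡r → p≢r (trans ℓ₂p≡ℓ₂q (cong proj₂ q≡r))
  ... | yes p≡r = p , q , t , separates cut₁ j ∘ cong proj₁ , p≢t ∘ cong proj₂ ,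
                  λ q≡t → p≢t (trans ℓ₂p≡ℓ₂q (cong proj₂ q≡t))
    where
    p≢t : ℓ₂ p ≢ ℓ₂ t
    p≢t p≡t = separates cut₂ k (trans (sym p≡r) p≡t)

  meets-≥ : ∀ {T c} → IsComplete G → IsSpanningTree G T → c ∈ˡ treeCycles G T →
            (n ∸ 3) * 2 ≤ cycleIntersectionNumber G T c
  meets-≥ {T} {c} complete tree@(connected , acyclic) c∈
    with e , tc ← ∈-treeCycles⁻ c∈
    with d₁ , d₂ , d₁≢d₂ , (d₁∈T , d₁∈c) , (d₂∈T , d₂∈c) ← two-tree-edges tc
    with ℓ₁ , cut₁ ← cut-exists tree d₁∈T | ℓ₂ , cut₂ ← cut-exists tree d₂∈T
    with α , β , γ , α≢β , α≢γ , β≢γ ← three-labels d₁∈T d₂∈T d₁≢d₂ cut₁ cut₂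
    with gs , ugs , cross , len ←
      crossing-edges complete _≟ᴸ_ (λ x → ℓ₁ x , ℓ₂ x) α≢β α≢γ β≢γ
        (others α β γ) (others-unique α β γ) (∈-others⁻ α β γ) =
    ≤-trans (*-monoˡ-≤ 2 (others-≥ α β γ)) (+-cancelˡ-≤ 3 _ _ (begin
      3 + length (others α β γ) * 2   ≡⟨ len ⟨
      length gs                       ≤⟨ length≤-by-⊆ ugs covers ⟩
      3 + length (filter rest? gs)    ≤⟨ +-monoʳ-≤ 3 (length≤-by (TreeCycle T) (chord-injective acyclic)
                                        (Unique.filter⁺ rest? ugs) total) ⟩
      3 + cycleIntersectionNumber G T c ∎))
    where
    open ≤-Reasoning

    rest? : Decidable (λ g → ¬ (g ∈ˡ (d₁ ∷ d₂ ∷ e ∷ [])))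
    rest? g = ¬? (any? (g ≟_) (d₁ ∷ d₂ ∷ e ∷ []))

    covers : ∀ {g} → g ∈ˡ gs → g ∈ˡ (d₁ ∷ d₂ ∷ e ∷ filter rest? gs)
    covers {g} g∈ with any? (g ≟_) (d₁ ∷ d₂ ∷ e ∷ [])
    ... | yes p = ∈-++⁺ˡ p
    ... | no ¬p = there (there (there (∈-filter⁺ rest? g∈ ¬p)))

    -- The only tree edges that change the label are d₁ and d₂.
    chord : ∀ {f u v} → Joins f u v → (ℓ₁ u , ℓ₂ u) ≢ (ℓ₁ v , ℓ₂ v) →
            f ∉ˡ (d₁ ∷ d₂ ∷ e ∷ []) → f ∉ T
    chord j ℓu≢ℓv f∉ f∈T = ℓu≢ℓv (cong₂ _,_
      (preserves cut₁ f∈T (f∉ ∘ here) j)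
      (preserves cut₂ f∈T (f∉ ∘ there ∘ here) j))

    meets : ∀ {f c′ u v} → TreeCycle T f c′ → Joins f u v →
            (ℓ₁ u , ℓ₂ u) ≢ (ℓ₁ v , ℓ₂ v) → Nonempty (intersection G T c c′)
    meets {u = u} {v} tc′ j ℓu≢ℓv with ℓ₁ u ≟ᵇ ℓ₁ v
    ... | no ℓ₁≢ = d₁ , x∈p∩q⁺ (d₁∈T , x∈p∩q⁺ (d₁∈c , crossing⇒∈ tc′ cut₁ j acyclic ℓ₁≢))
    ... | yes ℓ₁≡ = d₂ , x∈p∩q⁺ (d₂∈T , x∈p∩q⁺ (d₂∈c ,
      crossing⇒∈ tc′ cut₂ j acyclic λ ℓ₂≡ → ℓu≢ℓv (cong₂ _,_ ℓ₁≡ ℓ₂≡)))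

    total : ∀ {f} → f ∈ˡ filter rest? gs →
            ∃ λ c′ → c′ ∈ˡ meeting T c × TreeCycle T f c′
    total {f} f∈
      with f∈gs , f∉ ← ∈-filter⁻ rest? {xs = gs} f∈
      with u , v , j , ℓu≢ℓv , _ ← All.lookup cross f∈gs
      with c′ , tc′ ← tree-cycle-exists connected (chord j ℓu≢ℓv f∉) =
      c′ , ∈-filter⁺ (meets? T c) (∈-treeCycles⁺ tc′) (c′≢c , meets tc′ j ℓu≢ℓv) , tc′
      where
      c′≢c : c′ ≢ c
      c′≢c refl = f∉ (there (there (here (chord-injective acyclic tc′ tc))))

corollary7 : ∀ (n m : ℕ) → 3 ≤ n →
    (Kₙ : Graph n m) → IsComplete Kₙ →
    (Tₛ : Subset m) → IsStarSpanningTree Kₙ Tₛ →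
    (T : Subset m) → IsSpanningTree Kₙ T →
    treeIntersectionNumber Kₙ Tₛ ≤ treeIntersectionNumber Kₙ T
corollary7 n m _ Kₙ complete Tₛ star T tree = ⌊n/2⌋-mono (begin
  sum (map (cycleIntersectionNumber Kₙ Tₛ) (treeCycles Kₙ Tₛ))
    ≤⟨ sum-≤ _ _ (treeCycles Kₙ Tₛ) (star-meets-≤ Kₙ star) ⟩
  length (treeCycles Kₙ Tₛ) * ((n ∸ 3) * 2)
    ≤⟨ *-monoˡ-≤ ((n ∸ 3) * 2) (star-treeCycles≤ Kₙ tree star) ⟩
  length (treeCycles Kₙ T) * ((n ∸ 3) * 2)
    ≤⟨ sum-≥ _ _ (treeCycles Kₙ T) (meets-≥ Kₙ complete tree) ⟩
  sum (map (cycleIntersectionNumber Kₙ T) (treeCycles Kₙ T)) ∎)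
  where open ≤-Reasoning
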